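{- Let $(C,e,\lambda,\oplus)$ be the free Catalan structure with secondary operations $\gamma,\ominus$, and let $M=h\circ\mathrm{rev}\colon C\to C$, with $h$, $\mathrm{rev}$, $\gamma$, $\ominus$ as defined in the context. Then for all $t,u,v\in C$, $$M(e)=e,\qquad M(\lambda(t))=\gamma(M(t)),\qquad M(u\oplus v)=M(u)\ominus M(v).$$
   Context: A Catalan structure is a quadruple $(C,e,\lambda,\oplus)$ where $C=\bigsqcup_{n\ge 0}C_n$ with $C_0=\{e\}$ ($|t|=n$ for $t\in C_n$), $\lambda\colon C_n\to C_{n+1}$, $\oplus\colon C_m\times C_n\to C_{m+n}$, $\oplus$ is associative with two-sided identity $e$, and every $t\in C$ can be written uniquely in exactly one of three forms: $t=e$; $t=\lambda(s)$ with $s\in C$ (indecomposable); $t=u\oplus v$ with $u$ indecomposable and $v\in C\setminus C_0$ (decomposable). Hence every nonempty $t$ is uniquely $\lambda(u)\oplus v$ ($v=e$ allowed). The free Catalan structure is realized by the formal expressions $e$, $\lambda(t)$, $\lambda(u)\oplus v$ with $v\ne e$; it is isomorphic to rooted plane trees written as lists of children, with $e=[\,]$, $\lambda(T)=[T]$, $\oplus$ = concatenation of child lists. Secondary operations: $\gamma(t)=t\oplus\lambda(e)$, and $\ominus$ is defined by $e\ominus v=v$, $\lambda(u)\ominus v=\lambda(u\ominus v)$, $(t\oplus u)\ominus v=t\oplus(u\ominus v)$ for $t,u\ne e$ (well defined; one may take $t$ indecomposable). The maps: $h(e)=e$, $h(\lambda(u)\oplus v)=h(v)\ominus\gamma(h(u))$;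 $\mathrm{rev}(e)=e$, $\mathrm{rev}(\lambda(u)\oplus v)=\mathrm{rev}(v)\oplus\lambda(\mathrm{rev}(u))$. -}

module Defs where

open import Data.Nat using (ℕ; suc; _+_)
open import Data.Nat.Properties using (+-assoc; +-identityʳ)
open import Data.List using (List; []; _∷_; _++_)
open import Data.List.Properties using (++-assoc; ++-identityʳ)
open import Data.Product using (∃; ∃₂; _×_; _,_)
open import Data.Sum using (_⊎_; inj₁; inj₂)
open import Data.Empty using (⊥-elim)
open import Function using (_∘_)
open import Function.Bundles using (_⇔_; mk⇔)
open import Relation.Nullary using (¬_)
open import Relation.Binary.PropositionalEquality
  using (_≡_; _≢_; refl; sym; trans; cong)

-- The grading C = ⨆ₙ Cₙ is carried by the size function: Cₙ = { t | ∣ t ∣ ≡ n }.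
record IsCatalanStructure {C : Set} (∣_∣ : C → ℕ) (e : C) (ƛ : C → C)
                          (_⊕_ : C → C → C) : Set where
  Indecomposable : C → Set
  Indecomposable t = ∃ λ s → t ≡ ƛ s

  Decomposable : C → Set
  Decomposable t = ∃₂ λ u v → Indecomposable u × v ≢ e × t ≡ u ⊕ v

  field
    size-0 : ∀ t → (∣ t ∣ ≡ 0) ⇔ (t ≡ e)
    size-ƛ : ∀ t → ∣ ƛ t ∣ ≡ suc ∣ t ∣
    size-⊕ : ∀ u v → ∣ u ⊕ v ∣ ≡ ∣ u ∣ + ∣ v ∣

    ⊕-assoc     : ∀ t u v → (t ⊕ u) ⊕ v ≡ t ⊕ (u ⊕ v)
    ⊕-identityˡ : ∀ t → e ⊕ t ≡ t
    ⊕-identityʳ : ∀ t → t ⊕ e ≡ t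

    decompose : ∀ t → t ≡ e ⊎ Indecomposable t ⊎ Decomposable t
    e-¬indecomposable : ¬ Indecomposable e
    e-¬decomposable   : ¬ Decomposable e
    indecomposable⇒¬decomposable : ∀ {t} → Indecomposable t → ¬ Decomposable t
    ƛ-injective : ∀ {s t} → ƛ s ≡ ƛ t → s ≡ t
    ⊕-unique : ∀ {u u′ v v′} → Indecomposable u → Indecomposable u′ →
               v ≢ e → v′ ≢ e → u ⊕ v ≡ u′ ⊕ v′ → u ≡ u′ × v ≡ v′

-- The free Catalan structure as rooted plane trees, a tree being its list of
-- children; thus node (u ∷ us) is ƛ u ⊕ node us.
data Tree : Set where
  node : List Tree → Tree

infixr 6 _⊕_ _⊖_

e : Tree
e = node []

ƛ : Tree → Tree
ƛ t = node (t ∷ [])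

_⊕_ : Tree → Tree → Tree
node us ⊕ node vs = node (us ++ vs)

∣_∣ : Tree → ℕ
∣ node [] ∣       = 0
∣ node (u ∷ us) ∣ = suc (∣ u ∣ + ∣ node us ∣)

γ : Tree → Tree
γ t = t ⊕ ƛ e

-- Recursion on an indecomposable left summand; ⊖-⊕ below gives the defining
-- equation for an arbitrary decomposition into nonempty parts.
_⊖_ : Tree → Tree → Tree
node []            ⊖ v = v
node (u ∷ [])      ⊖ v = ƛ (u ⊖ v)
node (u ∷ w ∷ ws)  ⊖ v = ƛ u ⊕ (node (w ∷ ws) ⊖ v)

h : Tree → Tree
h (node [])       = e
h (node (u ∷ us)) = h (node us) ⊖ γ (h u)

rev : Tree → Tree
rev (node [])       = e
rev (node (u ∷ us)) = rev (node us) ⊕ ƛ (rev u)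

M : Tree → Tree
M = h ∘ rev

private
  assoc : ∀ t u v → (t ⊕ u) ⊕ v ≡ t ⊕ (u ⊕ v)
  assoc (node ts) (node us) (node vs) = cong node (++-assoc ts us vs)

  size-⊕′ : ∀ u v → ∣ u ⊕ v ∣ ≡ ∣ u ∣ + ∣ v ∣
  size-⊕′ (node [])       (node vs) = refl
  size-⊕′ (node (u ∷ us)) (node vs) = cong suc
    (trans (cong (∣ u ∣ +_) (size-⊕′ (node us) (node vs)))
           (sym (+-assoc (∣ u ∣) (∣ node us ∣) (∣ node vs ∣))))

Tree-isCatalanStructure : IsCatalanStructure ∣_∣ e ƛ _⊕_
Tree-isCatalanStructure = record
  { size-0 = λ { (node [])      → mk⇔ (λ _ → refl) (λ _ → refl)
               ; (node (_ ∷ _)) → mk⇔ (λ ()) (λ ()) }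
  ; size-ƛ = λ t → cong suc (+-identityʳ ∣ t ∣)
  ; size-⊕ = size-⊕′
  ; ⊕-assoc = assoc
  ; ⊕-identityˡ = λ { (node _) → refl }
  ; ⊕-identityʳ = λ { (node ts) → cong node (++-identityʳ ts) }
  ; decompose = λ
      { (node [])           → inj₁ refl
      ; (node (u ∷ []))     → inj₂ (inj₁ (u , refl))
      ; (node (u ∷ w ∷ ws)) →
          inj₂ (inj₂ (ƛ u , node (w ∷ ws) , (u , refl) , (λ ()) , refl)) }
  ; e-¬indecomposable = λ { (_ , ()) }
  ; e-¬decomposable = λ { (_ , node _ , (_ , refl) , _ , ()) }
  ; indecomposable⇒¬decomposable = λ
      { (_ , refl) (_ , node []      , (_ , refl) , v≢e , _) → v≢e refl
      ; (_ , refl) (_ , node (_ ∷ _) , (_ , refl) , _ , ()) }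
  ; ƛ-injective = λ { refl → refl }
  ; ⊕-unique = λ { {v = node _} {v′ = node _} (_ , refl) (_ , refl) _ _ refl → refl , refl }
  }

⊖-e : ∀ v → e ⊖ v ≡ v
⊖-e v = refl

⊖-ƛ : ∀ u v → ƛ u ⊖ v ≡ ƛ (u ⊖ v)
⊖-ƛ u v = refl

⊖-⊕ : ∀ t u v → t ≢ e → u ≢ e → (t ⊕ u) ⊖ v ≡ t ⊕ (u ⊖ v)
⊖-⊕ (node [])           u               v t≢e u≢e = ⊥-elim (t≢e refl)
⊖-⊕ (node (_ ∷ _))      (node [])       v t≢e u≢e = ⊥-elim (u≢e refl)
⊖-⊕ (node (x ∷ []))     (node (_ ∷ _))  v t≢e u≢e = refl
⊖-⊕ (node (x ∷ y ∷ ys)) u@(node (_ ∷ _)) v t≢e u≢e =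
  trans (cong (ƛ x ⊕_) (⊖-⊕ (node (y ∷ ys)) u v (λ ()) u≢e))
        (sym (assoc (ƛ x) (node (y ∷ ys)) (u ⊖ v)))

h-⊕ : ∀ u v → h (ƛ u ⊕ v) ≡ h v ⊖ γ (h u)
h-⊕ u (node _) = refl

rev-⊕ : ∀ u v → rev (ƛ u ⊕ v) ≡ rev v ⊕ ƛ (rev u)
rev-⊕ u (node _) = refl

{-# OPTIONS --safe #-}
-- rev reverses ⊕, and h turns ⊕ into ⊖ with the order of the factors reversed,
-- since (Tree , ⊖ , e) is a monoid; the two reversals cancel in M = h ∘ rev.
module Submission where

open import Data.List using ([]; _∷_; _++_)
open import Data.Product using (_×_; _,_)
open import Relation.Binary.PropositionalEquality
  using (_≡_; _≢_; refl; sym; trans; cong; module ≡-Reasoning)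
open import Defs

open IsCatalanStructure Tree-isCatalanStructure
  using (⊕-assoc; ⊕-identityʳ)
open ≡-Reasoning

-- On a list of children, `rev` and `h` are folds multiplying one factor per child in reverse order,
-- `ƛ (rev x)` under `⊕` and `γ (h x)` under `⊖`. Associativity then makes both anti-homomorphisms.

ƛ⊕≢e : ∀ u v → ƛ u ⊕ v ≢ e
ƛ⊕≢e u (node _) ()

⊖-nonempty : ∀ u us v → node (u ∷ us) ⊖ v ≢ e
⊖-nonempty u []       v ()
⊖-nonempty u (w ∷ ws) v = ƛ⊕≢e u (node (w ∷ ws) ⊖ v)

⊖-identityʳ : ∀ t → t ⊖ e ≡ t
⊖-identityʳ (node [])           = refl
⊖-identityʳ (node (u ∷ []))     = cong ƛ (⊖-identityʳ u)
⊖-identityʳ (node (u ∷ w ∷ ws)) = cong (ƛ u ⊕_) (⊖-identityʳ (node (w ∷ ws)))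

-- `t ⊖ v` grafts `v` onto the rightmost leaf of `t`, and the rightmost leaf of `t ⊖ u` is that of
-- the grafted `u`.
⊖-assoc : ∀ t u v → (t ⊖ u) ⊖ v ≡ t ⊖ (u ⊖ v)
⊖-assoc (node [])           u v = refl
⊖-assoc (node (x ∷ []))     u v = cong ƛ (⊖-assoc x u v)
⊖-assoc (node (x ∷ y ∷ ys)) u v = trans
  (⊖-⊕ (ƛ x) (node (y ∷ ys) ⊖ u) v (λ ()) (⊖-nonempty y ys u))
  (cong (ƛ x ⊕_) (⊖-assoc (node (y ∷ ys)) u v))

rev-antihomo-⊕ : ∀ u v → rev (u ⊕ v) ≡ rev v ⊕ rev u
rev-antihomo-⊕ (node [])       v@(node _)  = sym (⊕-identityʳ (rev v))
rev-antihomo-⊕ (node (x ∷ xs)) v@(node vs) = begin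
  rev (node (xs ++ vs)) ⊕ ƛ (rev x)     ≡⟨ cong (_⊕ ƛ (rev x)) (rev-antihomo-⊕ (node xs) v) ⟩
  (rev v ⊕ rev (node xs)) ⊕ ƛ (rev x)   ≡⟨ ⊕-assoc (rev v) (rev (node xs)) (ƛ (rev x)) ⟩
  rev v ⊕ rev (node xs) ⊕ ƛ (rev x)     ∎

h-antihomo : ∀ u v → h (u ⊕ v) ≡ h v ⊖ h u
h-antihomo (node [])       v@(node _)  = sym (⊖-identityʳ (h v))
h-antihomo (node (x ∷ xs)) v@(node vs) = begin
  h (node (xs ++ vs)) ⊖ γ (h x)     ≡⟨ cong (_⊖ γ (h x)) (h-antihomo (node xs) v) ⟩
  (h v ⊖ h (node xs)) ⊖ γ (h x)     ≡⟨ ⊖-assoc (h v) (h (node xs)) (γ (h x)) ⟩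
  h v ⊖ h (node xs) ⊖ γ (h x)       ∎

M-homo : ∀ u v → M (u ⊕ v) ≡ M u ⊖ M v
M-homo u v = trans (cong h (rev-antihomo-⊕ u v)) (h-antihomo (rev v) (rev u))

theorem5p5 : (M e ≡ e) × (∀ (t : Tree) → M (ƛ t) ≡ γ (M t)) × (∀ (u v : Tree) → M (u ⊕ v) ≡ M u ⊖ M v)
-- For `ƛ t` both folds have a single factor, and `e ⊕_` and `e ⊖_` compute away.
theorem5p5 = refl , (λ _ → refl) , M-homo
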